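{- Let $i\ge 3$ be an odd integer and let $f$ be a positive integer with $f\equiv 0 \pmod{i+1}$. Then $$S_d\left(\frac{(3i+4)f}{i+1}+2,\ f\right)\le \left(3-\frac{2}{i+1}\right)d;$$ that is, there is a search algorithm for $\frac{(3i+4)f}{i+1}+2$ robots, at most $f$ of which are byzantine faulty, whose search time for a target at (unknown) distance $d$ from the origin is at most $\left(3-\frac{2}{i+1}\right)d$, for every $d>0$.
   Context: Model. $n$ robots with distinct identities start at time $0$ at the origin of the real line and move along the line with speed at most $1$, changing direction or speed at no cost. A target lies at an unknown point at distance $d>0$ from the origin, i.e. at $d$ or $-d$, with $d$ unknown to the robots. At most $f$ robots are faulty; the bound $f$ is known, but not which robots are faulty. A search algorithm assigns each robot a trajectory, known to all robots; a robot's further motion may depend on the messages broadcast so far (computation and communication take no time). A robot detects whether the target is at a point only by being there. The only messages are announcements "the target is here", heard instantly by all robots at any distance; each message automatically carries the true identity and true current location of its sender. A robot visiting a point silently is taken to claim that the target is not there. Reliable (non-faulty) robots follow the algorithm and report truthfully. Faulty robots are controlled by an adversary: they may stay silent at the target or announce the target where it is not; a faulty robot that broadcasts while off its assigned trajectory is thereby detected as faulty. The search is completed at the first time when some reliable robot has visited the target and announced it and all reliable robots can be certain of its location (every scenario with at most $f$ faulty robots consistent with the messages so far has the target at that location). For an algorithm, the search time $S_d(n,f)$ is the worst-case completion time over both positions $\pm d$ of the target, all choices of at most $f$ faulty robots, and all behaviours of the faulty robots. The inequality $S_d(n,f)\le cd$ means that there is an algorithm, not depending on $d$, with search time at most $cd$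 for every $d>0$. -}

module Defs where

open import Algebra.Structures using (IsCommutativeRing)
open import Data.Fin.Base as Fin using (Fin)
open import Data.Fin.Subset using (Subset; _∉_; ∣_∣)
open import Data.List.Base using (List; filter)
open import Data.List.Membership.Propositional using () renaming (_∈_ to _∈ₗ_)
open import Data.List.Relation.Unary.All using (All)
open import Data.List.Relation.Unary.AllPairs using (AllPairs)
open import Data.Nat.Base as ℕ using (ℕ; zero; suc)
open import Data.Product.Base using (Σ; ∃; _×_)
open import Data.Sum.Base using (_⊎_)
open import Relation.Binary.Bundles using (DecTotalOrder)
open import Relation.Binary.PropositionalEquality using (_≡_; _≢_)
open import Relation.Binary.Structures using (IsDecTotalOrder; IsStrictTotalOrder)
import Relation.Binary.Properties.DecTotalOrder as DecTotalOrderProperties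

-- The real numbers, characterised up to isomorphism as a Dedekind-complete
-- ordered field.  The order is decidable, as it is classically.
record CompleteOrderedField : Set₁ where
  infixl 6 _+_ _-_
  infixl 7 _*_ _÷_
  infix  8 -_
  infix  9 _⁻¹
  infix  4 _≤_
  field
    ℝ    : Set
    _+_  : ℝ → ℝ → ℝ
    _*_  : ℝ → ℝ → ℝ
    -_   : ℝ → ℝ
    0#   : ℝ
    1#   : ℝ
    _⁻¹  : ℝ → ℝ  -- the value at 0# is unconstrained
    _≤_  : ℝ → ℝ → Set
    isCommutativeRing : IsCommutativeRing _≡_ _+_ _*_ -_ 0# 1#
    0≢1               : 0# ≢ 1#
    *-inverseʳ        : ∀ x → x ≢ 0# → x * x ⁻¹ ≡ 1#
    isDecTotalOrder   : IsDecTotalOrder _≡_ _≤_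
    +-monoʳ-≤         : ∀ z {x y} → x ≤ y → z + x ≤ z + y
    *-nonNeg          : ∀ {x y} → 0# ≤ x → 0# ≤ y → 0# ≤ x * y

  IsUpperBound : (ℝ → Set) → ℝ → Set
  IsUpperBound P b = ∀ x → P x → x ≤ b

  field
    complete : ∀ (P : ℝ → Set) → ∃ P → ∃ (IsUpperBound P) →
               ∃ λ s → IsUpperBound P s × (∀ b → IsUpperBound P b → s ≤ b)

  _-_ : ℝ → ℝ → ℝ
  x - y = x + (- y)

  _÷_ : ℝ → ℝ → ℝ
  x ÷ y = x * y ⁻¹

  fromℕ : ℕ → ℝ
  fromℕ zero    = 0#
  fromℕ (suc n) = 1# + fromℕ n

  decTotalOrder : DecTotalOrder _ _ _
  decTotalOrder = record { isDecTotalOrder = isDecTotalOrder }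

  open DecTotalOrderProperties decTotalOrder public
    using (_<_; <-isStrictTotalOrder)
  open IsDecTotalOrder isDecTotalOrder public using (_≤?_)
  open IsStrictTotalOrder <-isStrictTotalOrder public using (_<?_)

module Search (𝓡 : CompleteOrderedField) where
  open CompleteOrderedField 𝓡

  -- Speed at most 1 means 1-Lipschitz in time.
  record IsTrajectory (x : ℝ → ℝ) : Set where
    field
      start   : x 0# ≡ 0#
      speed≤1 : ∀ s t → 0# ≤ s → s ≤ t →
                (x t - x s ≤ t - s) × (x s - x t ≤ t - s)

  -- The announcement "the target is here".
  record Message (n : ℕ) : Set where
    field
      time     : ℝ
      sender   : Fin n
      location : ℝ
  open Message public

  before : ∀ {n} → ℝ → List (Message n) → List (Message n)
  before t = filter (λ m → time m <? t)

  upTo : ∀ {n} → ℝ → List (Message n) → List (Message n)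
  upTo t = filter (λ m → time m ≤? t)

  -- Simultaneous messages are listed by sender, and a robot sends at most one
  -- message at a time, so a history is just a finite set of messages: list
  -- order carries no further information.
  _Precedes_ : ∀ {n} → Message n → Message n → Set
  m Precedes m′ =
    (time m < time m′) ⊎ (time m ≡ time m′ × sender m Fin.< sender m′)

  record IsHistory {n} (h : List (Message n)) : Set where
    field
      nonNegative   : All (λ m → 0# ≤ time m) h
      chronological : AllPairs _Precedes_ h

  -- plan h r t is the position assigned to robot r at time t when h is the
  -- list of messages broadcast before t.  Messages broadcast at time t itself
  -- cannot affect the position at t, because the speed is bounded.
  record Algorithm (n : ℕ) : Set where
    field
      plan : List (Message n) → Fin n → ℝ → ℝ

    assigned : List (Message n) → Fin n → ℝ → ℝ
    assigned h r t = plan (before t h) r t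

    field
      assigned-legal : ∀ h → IsHistory h → ∀ r → IsTrajectory (assigned h r)

  -- A scenario: a target, a set of faulty robots, and everything that happens.
  -- Faulty robots may move and broadcast arbitrarily, subject to the speed
  -- bound and to the automatic sender and location stamps.
  record Run {n} (A : Algorithm n) (f : ℕ) : Set where
    open Algorithm A
    field
      target   : ℝ
      faulty   : Subset n
      position : Fin n → ℝ → ℝ
      messages : List (Message n)

      target≢0        : target ≢ 0#
      faulty-bound    : ∣ faulty ∣ ℕ.≤ f
      position-legal  : ∀ r → IsTrajectory (position r)
      messages-legal  : IsHistory messages
      location-true   : ∀ m → m ∈ₗ messages →
                        location m ≡ position (sender m) (time m)
      reliable-follow : ∀ r → r ∉ faulty → ∀ t → 0# ≤ t →
                        position r t ≡ assigned messages r t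
      reliable-honest : ∀ m → m ∈ₗ messages → sender m ∉ faulty →
                        location m ≡ target
      -- With reliable-honest, this forces an announcement at the first visit;
      -- repeating it on later visits is optional.
      reliable-report : ∀ r → r ∉ faulty → ∀ t → 0# ≤ t →
                        position r t ≡ target →
                        ∃ λ m → m ∈ₗ messages × sender m ≡ r × time m ≤ t
  open Run public

  module _ {n} {A : Algorithm n} {f : ℕ} where

    Announced : Run A f → ℝ → Set
    Announced ρ T = ∃ λ m → m ∈ₗ messages ρ × sender m ∉ faulty ρ ×
                            location m ≡ target ρ × time m ≤ T

    Certain : Run A f → ℝ → Set
    Certain ρ T = ∀ (σ : Run A f) →
                  upTo T (messages σ) ≡ upTo T (messages ρ) →
                  target σ ≡ target ρ

    Completed : Run A f → ℝ → Set
    Completed ρ T = Announced ρ T × Certain ρ T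

  -- Both conditions defining completion persist in time, so the first
  -- completion time is at most B exactly when completion holds at some T ≤ B.
  SearchTime≤ : ∀ {n} → Algorithm n → (f : ℕ) (d B : ℝ) → Set
  SearchTime≤ A f d B =
    ∀ (ρ : Run A f) → target ρ ≡ d ⊎ target ρ ≡ - d →
    ∃ λ T → T ≤ B × Completed ρ T

  -- S[ n , f ]≤ c  is the assertion  S_d(n, f) ≤ c d.
  S[_,_]≤_ : ℕ → ℕ → ℝ → Set
  S[ n , f ]≤ c =
    Σ (Algorithm n) λ A → ∀ d → 0# < d → SearchTime≤ A f d (c * d)

{-# OPTIONS --safe #-}
module Submission where

-- The f + 1 robots of a left pack and the f + 1 robots of a right pack run away
-- from the origin at unit speed, while the at least f remaining scouts move
-- together: at each time t towards the side on which more pack members have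
-- announced anything so far, at unit speed but within |x| ≤ t / 2.  Once a pack
-- has passed the target at distance d, its reliable members have all announced,
-- and announcers in the other pack are faulty; hence the reliable members of the
-- first pack outweigh all liars and the scouts move towards the target from then
-- on.  At time d they are within d / 2 of the origin, so they reach the target by
-- time 5d/2, which is at most the required bound since i ≥ 3.  By then more than
-- 2f robots have visited the target, so that no other target is consistent.

open import Algebra.Bundles using (CommutativeRing)
open import Data.Bool.Base using (Bool)
open import Data.Fin.Properties using (any?)
open import Data.Fin.Subset
  using (Subset; inside; outside; _∈_; _∉_; _⊆_; _∩_; _∪_; _─_; ∁; ⊥; ⁅_⁆; ∣_∣)
open import Data.Fin.Subset.Properties
  using (_∈?_; p⊆q⇒∣p∣≤∣q∣; ∣∁p∣≡n∸∣p∣; x∈p∩q⁺; x∈p∩q⁻; x∈p∪q⁺; x∈p∪q⁻; p⊆p∪q; ∉⊥;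
         x∈p∧x∉q⇒x∈p─q; x∈⁅x⁆; x∈⁅y⁆⇒x≡y; ∣⊤∣≡n; ∣⊥∣≡0; x∈∁p⇒x∉p)
open import Data.List.Base using (List; []; _∷_; foldl)
open import Data.List.Membership.Propositional using () renaming (_∈_ to _∈ₗ_)
open import Data.List.Membership.Propositional.Properties using (∈-filter⁺; ∈-filter⁻)
open import Data.List.Properties using (filter-accept; filter-reject)
open import Data.List.Relation.Unary.All as All using (All; []; _∷_)
open import Data.List.Relation.Unary.AllPairs using (AllPairs; []; _∷_)
open import Data.List.Relation.Unary.Any using (here; there)
open import Data.Maybe.Base using (Maybe; just; nothing)
open import Data.Nat as ℕ using (ℕ; zero; suc)
open import Data.Nat.DivMod using (m*n/n≡m)
import Data.Nat.Properties as ℕ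
open import Data.Nat.Tactic.RingSolver using (solve-∀)
open import Data.Product using (∃; _×_; _,_; proj₁; proj₂)
open import Data.Sum using (_⊎_; inj₁; inj₂)
open import Data.Unit using (tt) renaming (⊤ to Unit)
open import Data.Vec.Base as Vec using (Vec; []; _∷_; lookup; replicate)
open import Data.Vec.Properties
  using (map-++; map-replicate; lookup-map; []=⇒lookup; lookup⇒[]=)
open import Function using (_∘_)
open import Relation.Binary.Bundles using (DecTotalOrder)
open import Relation.Binary.Definitions using (Tri; tri<; tri≈; tri>)
open import Relation.Binary.PropositionalEquality
open import Relation.Nullary using (yes; no; ¬_; contradiction)
open import Relation.Nullary.Decidable using (_×-dec_; ¬?; decidable-stable)

open import Defs

-- Cardinalities of finite subsets.

∣p∩q∣+∣p─q∣≡∣p∣ : ∀ {n} (p q : Subset n) → ∣ p ∩ q ∣ ℕ.+ ∣ p ─ q ∣ ≡ ∣ p ∣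
∣p∩q∣+∣p─q∣≡∣p∣ []            []            = refl
∣p∩q∣+∣p─q∣≡∣p∣ (outside ∷ p) (outside ∷ q) = ∣p∩q∣+∣p─q∣≡∣p∣ p q
∣p∩q∣+∣p─q∣≡∣p∣ (outside ∷ p) (inside ∷ q)  = ∣p∩q∣+∣p─q∣≡∣p∣ p q
∣p∩q∣+∣p─q∣≡∣p∣ (inside ∷ p)  (inside ∷ q)  = cong suc (∣p∩q∣+∣p─q∣≡∣p∣ p q)
∣p∩q∣+∣p─q∣≡∣p∣ (inside ∷ p)  (outside ∷ q) =
  trans (ℕ.+-suc _ _) (cong suc (∣p∩q∣+∣p─q∣≡∣p∣ p q))

∣p∪q∣≤∣p∣+∣q∣ : ∀ {n} (p q : Subset n) → ∣ p ∪ q ∣ ℕ.≤ ∣ p ∣ ℕ.+ ∣ q ∣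
∣p∪q∣≤∣p∣+∣q∣ []            []            = ℕ.z≤n
∣p∪q∣≤∣p∣+∣q∣ (outside ∷ p) (outside ∷ q) = ∣p∪q∣≤∣p∣+∣q∣ p q
∣p∪q∣≤∣p∣+∣q∣ (outside ∷ p) (inside ∷ q)  =
  ℕ.≤-trans (ℕ.s≤s (∣p∪q∣≤∣p∣+∣q∣ p q)) (ℕ.≤-reflexive (sym (ℕ.+-suc _ _)))
∣p∪q∣≤∣p∣+∣q∣ (inside ∷ p)  (outside ∷ q) = ℕ.s≤s (∣p∪q∣≤∣p∣+∣q∣ p q)
∣p∪q∣≤∣p∣+∣q∣ (inside ∷ p)  (inside ∷ q)  =
  ℕ.s≤s (ℕ.≤-trans (∣p∪q∣≤∣p∣+∣q∣ p q) (ℕ.+-monoʳ-≤ ∣ p ∣ (ℕ.n≤1+n _)))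

∣p++q∣≡∣p∣+∣q∣ : ∀ {m n} (p : Subset m) (q : Subset n) → ∣ p Vec.++ q ∣ ≡ ∣ p ∣ ℕ.+ ∣ q ∣
∣p++q∣≡∣p∣+∣q∣ []            q = refl
∣p++q∣≡∣p∣+∣q∣ (outside ∷ p) q = ∣p++q∣≡∣p∣+∣q∣ p q
∣p++q∣≡∣p∣+∣q∣ (inside ∷ p)  q = cong suc (∣p++q∣≡∣p∣+∣q∣ p q)

∣map-++∣ : ∀ {A : Set} {m n} (g : A → Bool) (xs : Vec A m) (ys : Vec A n) →
           ∣ Vec.map g (xs Vec.++ ys) ∣ ≡ ∣ Vec.map g xs ∣ ℕ.+ ∣ Vec.map g ys ∣
∣map-++∣ g xs ys = trans (cong ∣_∣ (map-++ g xs ys)) (∣p++q∣≡∣p∣+∣q∣ (Vec.map g xs) (Vec.map g ys))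

∃∈-∉ : ∀ {n} {p q : Subset n} → ∣ q ∣ ℕ.< ∣ p ∣ → ∃ λ r → r ∈ p × r ∉ q
∃∈-∉ {p = p} {q} q<p with any? (λ r → (r ∈? p) ×-dec ¬? (r ∈? q))
... | yes found = found
... | no ¬found = contradiction (p⊆q⇒∣p∣≤∣q∣ p⊆q) (ℕ.<⇒≱ q<p)
  where
  p⊆q : p ⊆ q
  p⊆q {r} r∈p = decidable-stable (r ∈? q) λ r∉q → ¬found (r , r∈p , r∉q)

-- Comparing the announcers of two packs exposes the truth: the announcers
-- B ∩ H of the wrong pack and the silent part of the right pack A are all in
-- F, and these two sets are disjoint.
truthful-majority : ∀ {n} (A B F H : Subset n) → ∣ F ∣ ℕ.< ∣ A ∣ →
                    (∀ {r} → r ∈ A → r ∉ F → r ∈ H) →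
                    (∀ {r} → r ∈ B → r ∈ H → r ∈ F) →
                    ∣ B ∩ H ∣ ℕ.< ∣ A ∩ H ∣
truthful-majority A B F H F<A heard lying = ℕ.+-cancelʳ-< ∣ F ─ B∩H ∣ _ _ (begin-strict
  ∣ B∩H ∣ ℕ.+ ∣ F ─ B∩H ∣       ≤⟨ ℕ.+-monoˡ-≤ _ (p⊆q⇒∣p∣≤∣q∣ B∩H⊆F∩) ⟩
  ∣ F ∩ B∩H ∣ ℕ.+ ∣ F ─ B∩H ∣   ≡⟨ ∣p∩q∣+∣p─q∣≡∣p∣ F B∩H ⟩
  ∣ F ∣                       <⟨ F<A ⟩
  ∣ A ∣                       ≤⟨ p⊆q⇒∣p∣≤∣q∣ A⊆ ⟩
  ∣ (A ∩ H) ∪ (F ─ B∩H) ∣     ≤⟨ ∣p∪q∣≤∣p∣+∣q∣ (A ∩ H) (F ─ B∩H) ⟩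
  ∣ A ∩ H ∣ ℕ.+ ∣ F ─ B∩H ∣     ∎)
  where
  open ℕ.≤-Reasoning
  B∩H = B ∩ H
  B∩H⊆F∩ : B∩H ⊆ F ∩ B∩H
  B∩H⊆F∩ r∈ with r∈B , r∈H ← x∈p∩q⁻ B H r∈ = x∈p∩q⁺ (lying r∈B r∈H , r∈)
  A⊆ : A ⊆ (A ∩ H) ∪ (F ─ B∩H)
  A⊆ {r} r∈A with r ∈? H | r ∈? F
  ... | yes r∈H | _       = x∈p∪q⁺ (inj₁ (x∈p∩q⁺ (r∈A , r∈H)))
  ... | no r∉H  | no r∉F  = contradiction (heard r∈A r∉F) r∉H
  ... | no r∉H  | yes r∈F =
    x∈p∪q⁺ (inj₂ (x∈p∧x∉q⇒x∈p─q r∈F (r∉H ∘ proj₂ ∘ x∈p∩q⁻ B H)))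

-- Arithmetic and order in the field of real numbers.

module OrderedField (𝓡 : CompleteOrderedField) where
  open CompleteOrderedField 𝓡

  commutativeRing : CommutativeRing _ _
  commutativeRing = record { isCommutativeRing = isCommutativeRing }

  open CommutativeRing commutativeRing public
    using (+-comm; +-assoc; *-comm; *-assoc; *-identityˡ; *-identityʳ; +-identityˡ; +-identityʳ;
           -‿inverseʳ; -‿inverseˡ; distribˡ; distribʳ; ring; commutativeSemiring)
  open import Algebra.Properties.Ring ring public
    using (-‿involutive; -0#≈0#; -‿distribʳ-*)
  open import Algebra.Solver.Ring.NaturalCoefficients.Default commutativeSemiring
    using (solve; _:=_; _:+_; _:*_; con)
  open DecTotalOrder decTotalOrder public
    using (totalOrder; _≟_)
    renaming (refl to ≤-refl; trans to ≤-trans;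
              total to ≤-total; reflexive to ≤-reflexive)
  open import Relation.Binary.Properties.DecTotalOrder decTotalOrder public
    using (≮⇒≥; <⇒≱; ≤∧≉⇒<; ≰⇒>; <-trans)
    renaming (<-compare to <-cmp)
  open import Algebra.Construct.NaturalChoice.Min totalOrder public
    using (_⊓_; x⊓y≤x; x⊓y≤y; ⊓-glb; ⊓-assoc; x≤y⇒x⊓y≈x; x≤y⇒y⊓x≈x; mono-≤-distrib-⊓)

  +-monoˡ-≤ : ∀ z {x y} → x ≤ y → x + z ≤ y + z
  +-monoˡ-≤ z {x} {y} x≤y = subst₂ _≤_ (+-comm z x) (+-comm z y) (+-monoʳ-≤ z x≤y)

  +-mono-≤ : ∀ {a b x y} → a ≤ b → x ≤ y → a + x ≤ b + y
  +-mono-≤ {b = b} {x} a≤b x≤y = ≤-trans (+-monoˡ-≤ x a≤b) (+-monoʳ-≤ b x≤y)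

  x+z-z≡x : ∀ x z → x + z - z ≡ x
  x+z-z≡x x z = trans (+-assoc x z (- z)) (trans (cong (x +_) (-‿inverseʳ z)) (+-identityʳ x))

  x-z+z≡x : ∀ x z → x - z + z ≡ x
  x-z+z≡x x z = trans (+-assoc x (- z) z) (trans (cong (x +_) (-‿inverseˡ z)) (+-identityʳ x))

  +-cancelʳ-≤ : ∀ z {x y} → x + z ≤ y + z → x ≤ y
  +-cancelʳ-≤ z {x} {y} le = subst₂ _≤_ (x+z-z≡x x z) (x+z-z≡x y z) (+-monoˡ-≤ (- z) le)

  +-cancelʳ-≡ : ∀ z {x y} → x + z ≡ y + z → x ≡ y
  +-cancelʳ-≡ z {x} {y} eq = trans (sym (x+z-z≡x x z)) (trans (cong (_- z) eq) (x+z-z≡x y z))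

  -- The identity says that `x - y` equals `a - b`. It is written with sums only, which puts it
  -- within reach of a semiring solver.
  ≤-from : ∀ {a b x y} → a ≤ b → x + b ≡ y + a → x ≤ y
  ≤-from {a} {b} {x} {y} a≤b eq =
    +-cancelʳ-≤ b (≤-trans (≤-reflexive eq) (+-monoʳ-≤ y a≤b))

  neg-antimono-≤ : ∀ {x y} → x ≤ y → - y ≤ - x
  neg-antimono-≤ {x} {y} x≤y =
    ≤-from x≤y (trans (-‿inverseˡ y) (sym (-‿inverseˡ x)))

  ≤-add⇒sub-≤ : ∀ {a b c d} → a + d ≤ c + b → a - b ≤ c - d
  ≤-add⇒sub-≤ {a} {b} {c} {d} le = +-cancelʳ-≤ (b + d)
    (subst₂ _≤_ (sym (eq a b d)) (sym (trans (cong (c - d +_) (+-comm b d)) (eq c d b))) le)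
    where
    eq : ∀ x y z → x - y + (y + z) ≡ x + z
    eq x y z = trans (sym (+-assoc (x - y) y z)) (cong (_+ z) (x-z+z≡x x y))

  ≤-<-trans : ∀ {x y z} → x ≤ y → y < z → x < z
  ≤-<-trans x≤y y<z = ≰⇒> λ z≤x → <⇒≱ y<z (≤-trans z≤x x≤y)

  0≤1 : 0# ≤ 1#
  0≤1 with ≤-total 0# 1#
  ... | inj₁ 0≤1 = 0≤1
  ... | inj₂ 1≤0 = subst (0# ≤_) -1*-1≡1 (*-nonNeg 0≤-1 0≤-1)
    where
    0≤-1 : 0# ≤ - 1#
    0≤-1 = subst (_≤ - 1#) -0#≈0# (neg-antimono-≤ 1≤0)
    -1*-1≡1 : - 1# * - 1# ≡ 1#
    -1*-1≡1 = trans (sym (-‿distribʳ-* (- 1#) 1#))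
      (trans (cong -_ (*-identityʳ (- 1#))) (-‿involutive 1#))

  0<1 : 0# < 1#
  0<1 = ≤∧≉⇒< 0≤1 0≢1

  0<⇒≢0 : ∀ {x} → 0# < x → x ≢ 0#
  0<⇒≢0 0<x x≡0 = proj₂ 0<x (sym x≡0)

  +-pos-nonNeg : ∀ {x y} → 0# < x → 0# ≤ y → 0# < x + y
  +-pos-nonNeg {x} {y} 0<x 0≤y = ≰⇒> λ x+y≤0 →
    <⇒≱ 0<x (≤-trans (subst (_≤ x + y) (+-identityʳ x) (+-monoʳ-≤ x 0≤y)) x+y≤0)

  fromℕ-nonNeg : ∀ n → 0# ≤ fromℕ n
  fromℕ-nonNeg zero    = ≤-refl
  fromℕ-nonNeg (suc n) = subst (_≤ 1# + fromℕ n) (+-identityʳ 0#) (+-mono-≤ 0≤1 (fromℕ-nonNeg n))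

  fromℕ-pos : ∀ n → 0# < fromℕ (suc n)
  fromℕ-pos n = +-pos-nonNeg 0<1 (fromℕ-nonNeg n)

  fromℕ-mono-≤ : ∀ {m n} → m ℕ.≤ n → fromℕ m ≤ fromℕ n
  fromℕ-mono-≤ {n = n} ℕ.z≤n = fromℕ-nonNeg n
  fromℕ-mono-≤ (ℕ.s≤s m≤n)   = +-monoʳ-≤ 1# (fromℕ-mono-≤ m≤n)

  -- An inverse at most `0#` would make `x * - (x ⁻¹)`, which is `- 1#`, nonnegative.
  ⁻¹-nonNeg : ∀ {x} → 0# < x → 0# ≤ x ⁻¹
  ⁻¹-nonNeg {x} 0<x with ≤-total 0# (x ⁻¹)
  ... | inj₁ 0≤x⁻¹ = 0≤x⁻¹
  ... | inj₂ x⁻¹≤0 = contradiction 0≤-1 (<⇒≱ -1<0)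
    where
    0≤-1 : 0# ≤ - 1#
    0≤-1 = subst (0# ≤_)
      (trans (sym (-‿distribʳ-* x (x ⁻¹))) (cong -_ (*-inverseʳ x (0<⇒≢0 0<x))))
      (*-nonNeg (proj₁ 0<x) (subst (_≤ - (x ⁻¹)) -0#≈0# (neg-antimono-≤ x⁻¹≤0)))
    -1<0 : - 1# < 0#
    -1<0 = ≰⇒> λ 0≤-1 → <⇒≱ 0<1
      (subst₂ _≤_ (-‿involutive 1#) -0#≈0# (neg-antimono-≤ 0≤-1))

  *-monoʳ-≤-nonNeg : ∀ {x y z} → 0# ≤ z → x ≤ y → z * x ≤ z * y
  *-monoʳ-≤-nonNeg {x} {y} {z} 0≤z x≤y =
    ≤-from (*-nonNeg 0≤z 0≤y-x)
      (trans (sym (distribˡ z x (y - x)))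
        (trans (cong (z *_) (trans (+-comm x (y - x)) (x-z+z≡x y x))) (sym (+-identityʳ (z * y)))))
    where
    0≤y-x : 0# ≤ y - x
    0≤y-x = subst (_≤ y - x) (-‿inverseʳ x) (+-monoˡ-≤ (- x) x≤y)

  double-cancel-≤ : ∀ {x y} → x + x ≤ y + y → x ≤ y
  double-cancel-≤ {x} {y} le with ≤-total x y
  ... | inj₁ x≤y = x≤y
  ... | inj₂ y≤x = +-cancelʳ-≤ x (≤-trans le (+-monoʳ-≤ y y≤x))

  half : ℝ → ℝ
  half x = x * fromℕ 2 ⁻¹

  half+half : ∀ x → half x + half x ≡ x
  half+half x = begin
    x * y + x * y         ≡⟨ solve 2 (λ x y → x :* y :+ x :* y := x :* (con 2 :* y)) refl x y ⟩
    x * ((1# + 1#) * y)   ≡⟨ cong (λ z → x * ((1# + z) * y)) (+-identityʳ 1#) ⟨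
    x * (fromℕ 2 * y)     ≡⟨ cong (x *_) (*-inverseʳ (fromℕ 2) (0<⇒≢0 (fromℕ-pos 1))) ⟩
    x * 1#                ≡⟨ *-identityʳ x ⟩
    x                     ∎
    where
    open ≡-Reasoning
    y = fromℕ 2 ⁻¹

  half-double : ∀ x → half (x + x) ≡ x
  half-double x = trans (distribʳ (fromℕ 2 ⁻¹) x x) (half+half x)

  half-mono-≤ : ∀ {x y} → x ≤ y → half x ≤ half y
  half-mono-≤ {x} {y} x≤y =
    double-cancel-≤ (subst₂ _≤_ (sym (half+half x)) (sym (half+half y)) x≤y)

  -- As `i + 1 ≥ 4`, the subtracted fraction is at most 1/2, so the factor of `d` is at least 5/2,
  -- the constant that the scouts achieve.
  5/2≤ratio : ∀ {i} → i ℕ.≥ 3 → ∀ {d} → 0# ≤ d →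
              d + d + half d ≤ (fromℕ 3 - fromℕ 2 ÷ fromℕ (suc i)) * d
  5/2≤ratio {i} i≥3 {d} 0≤d = begin
    d + d + half d        ≡⟨ solve 2 (λ d h → d :+ d :+ d :* h := d :* (con 2 :+ h)) refl d h ⟩
    d * (1# + 1# + h)     ≤⟨ *-monoʳ-≤-nonNeg 0≤d 2+h≤c ⟩
    d * c                 ≡⟨ *-comm d c ⟩
    c * d                 ∎
    where
    open import Relation.Binary.Reasoning.PartialOrder
      (DecTotalOrder.poset decTotalOrder)
    h = fromℕ 2 ⁻¹
    N = fromℕ (suc i)
    q = fromℕ 2 ÷ N
    c = fromℕ 3 - q
    h+h≡1 : h + h ≡ 1#
    h+h≡1 = trans (cong₂ _+_ (sym (*-identityˡ h)) (sym (*-identityˡ h))) (half+half 1#)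
    0≤q : 0# ≤ q
    0≤q = *-nonNeg (fromℕ-nonNeg 2) (⁻¹-nonNeg (fromℕ-pos i))
    q*N≡2 : q * N ≡ 1# + 1#
    q*N≡2 = trans (*-assoc (fromℕ 2) (N ⁻¹) N)
      (trans (cong (fromℕ 2 *_) (trans (*-comm (N ⁻¹) N) (*-inverseʳ N (0<⇒≢0 (fromℕ-pos i)))))
        (trans (*-identityʳ _) (cong (1# +_) (+-identityʳ 1#))))
    -- Comparing fourfold multiples avoids division: `4 q ≤ q N = 2 = 4 h`.
    q≤h : q ≤ h
    q≤h = double-cancel-≤ (double-cancel-≤ (begin
      (q + q) + (q + q)   ≡⟨ solve 1 (λ q → (q :+ q) :+ (q :+ q) :=
                               q :* (con 1 :+ (con 1 :+ (con 1 :+ (con 1 :+ con 0))))) refl q ⟩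
      q * fromℕ 4         ≤⟨ *-monoʳ-≤-nonNeg 0≤q (fromℕ-mono-≤ (ℕ.s≤s i≥3)) ⟩
      q * N               ≡⟨ q*N≡2 ⟩
      1# + 1#             ≡⟨ cong₂ _+_ h+h≡1 h+h≡1 ⟨
      (h + h) + (h + h)   ∎))
    2+h≤c : 1# + 1# + h ≤ c
    2+h≤c = +-cancelʳ-≤ q (begin
      1# + 1# + h + q                    ≤⟨ +-monoʳ-≤ _ q≤h ⟩
      1# + 1# + h + h                    ≡⟨ +-assoc _ h h ⟩
      1# + 1# + (h + h)                  ≡⟨ cong (1# + 1# +_) h+h≡1 ⟩
      1# + 1# + 1#                       ≡⟨ solve 0 (con 3 := con 1 :+ (con 1 :+ (con 1 :+ con 0))) refl ⟩
      fromℕ 3                            ≡⟨ x-z+z≡x (fromℕ 3) q ⟨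
      c + q                              ∎)

-- Kinematics on the line, and motion that responds to messages.

module Motion (𝓡 : CompleteOrderedField) where
  open CompleteOrderedField 𝓡
  open OrderedField 𝓡
  open Search 𝓡
  open import Algebra.Solver.Ring.NaturalCoefficients.Default commutativeSemiring
    using (solve; _:=_; _:+_)

  data Direction : Set where
    left right : Direction

  opposite : Direction → Direction
  opposite left  = right
  opposite right = left

  orient : Direction → ℝ → ℝ
  orient left  x = - x
  orient right x = x

  orient-involutive : ∀ s x → orient s (orient s x) ≡ x
  orient-involutive left  x = -‿involutive x
  orient-involutive right x = refl

  InCone : ℝ → ℝ → Set
  InCone t x = x ≤ half t × - x ≤ half t

  inCone-orient : ∀ s {t x} → InCone t x → InCone t (orient s x)
  inCone-orient left  {t} {x} (x≤ , -x≤) = -x≤ , subst (_≤ half t) (sym (-‿involutive x)) x≤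
  inCone-orient right cone               = cone

  -- The speed bound between the events `(s, x)` and `(t, y)`, in the two-sided form that
  -- `IsTrajectory` asks for.
  Reachable : (s t x y : ℝ) → Set
  Reachable s t x y = (y - x ≤ t - s) × (x - y ≤ t - s)

  reachable-orient : ∀ d {s t x y} → Reachable s t x y → Reachable s t (orient d x) (orient d y)
  reachable-orient right      r         = r
  reachable-orient left {s} {t} {x} {y} (y-x , x-y) =
    subst (_≤ t - s) (eq x y) x-y , subst (_≤ t - s) (eq y x) y-x
    where
    eq : ∀ x y → x - y ≡ - y - - x
    eq x y = trans (+-comm x (- y)) (cong (- y +_) (sym (-‿involutive x)))

  sub-telescope : ∀ x y z → (z - y) + (y - x) ≡ z - x
  sub-telescope x y z = trans (sym (+-assoc (z - y) y (- x))) (cong (_- x) (x-z+z≡x z y))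

  reachable-trans : ∀ {r s t x y z} → Reachable r s x y → Reachable s t y z → Reachable r t x z
  reachable-trans {r} {s} {t} {x} {y} {z} (y-x , x-y) (z-y , y-z) =
    subst₂ _≤_ (sub-telescope x y z) (sub-telescope r s t) (+-mono-≤ z-y y-x) ,
    subst₂ _≤_ (sub-telescope z y x) (trans (+-comm (s - r) (t - s)) (sub-telescope r s t))
      (+-mono-≤ x-y y-z)

  -- The motion to the right at unit speed from p at time t₀; staying in the cone
  -- costs nothing in the worst case, and keeps both half-lines within reach.
  advance : ℝ → ℝ → ℝ → ℝ
  advance t₀ p t = (p + (t - t₀)) ⊓ half t

  +-sub-comm : ∀ p t t₀ → p + (t - t₀) + t₀ ≡ p + t
  +-sub-comm p t t₀ = trans (+-assoc p (t - t₀) t₀) (cong (p +_) (x-z+z≡x t t₀))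

  -- The free motion only increases, and the edge of the cone is at or beyond `p` from time `t₀` on.
  -- This yields both the left side of the cone and one half of the speed bound.
  advance-≥ : ∀ {t₀ p t} → t₀ ≤ t → InCone t₀ p → p ≤ advance t₀ p t
  advance-≥ {t₀} {p} {t} t₀≤t (p≤ , _) = ⊓-glb
    (+-cancelʳ-≤ t₀ (subst (p + t₀ ≤_) (sym (+-sub-comm p t t₀)) (+-monoʳ-≤ p t₀≤t)))
    (≤-trans p≤ (half-mono-≤ t₀≤t))

  advance-inCone : ∀ {t₀ p t} → t₀ ≤ t → InCone t₀ p → InCone t (advance t₀ p t)
  advance-inCone {t₀} {p} {t} t₀≤t cone =
    x⊓y≤y _ _ ,
    ≤-trans (neg-antimono-≤ (advance-≥ t₀≤t cone)) (≤-trans (proj₂ cone) (half-mono-≤ t₀≤t))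

  advance-reachable : ∀ {t₀ p t} → t₀ ≤ t → InCone t₀ p → Reachable t₀ t p (advance t₀ p t)
  advance-reachable {t₀} {p} {t} t₀≤t cone =
    ≤-add⇒sub-≤ (subst (advance t₀ p t + t₀ ≤_) (trans (+-sub-comm p t t₀) (+-comm p t))
      (+-monoˡ-≤ t₀ (x⊓y≤x (p + (t - t₀)) (half t)))) ,
    ≤-add⇒sub-≤ (subst (p + t₀ ≤_) (+-comm _ t) (+-mono-≤ (advance-≥ t₀≤t cone) t₀≤t))

  advance-start : ∀ {t p} → InCone t p → advance t p t ≡ p
  advance-start {t} {p} (p≤ , _) =
    trans (cong (_⊓ half t) (trans (cong (p +_) (-‿inverseʳ t)) (+-identityʳ p)))
      (x≤y⇒x⊓y≈x p≤)

  half-speed≤1 : ∀ {s t} → s ≤ t → half t ≤ half s + (t - s)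
  half-speed≤1 {s} {t} s≤t = +-cancelʳ-≤ s
    (subst (half t + s ≤_) (sym (+-sub-comm (half s) t s))
      (subst₂ (λ s′ t′ → half t + s′ ≤ half s + t′) (half+half s) (half+half t)
        (≤-from (half-mono-≤ s≤t)
          (solve 2 (λ a b → b :+ (a :+ a) :+ b := a :+ (b :+ b) :+ a) refl (half s) (half t)))))

  -- The cap at time `s` can be forgotten: a point leaving the edge of the cone at unit speed is not
  -- overtaken by the edge, which moves at speed 1/2, so the cap at time `t` is at least as strict.
  advance-advance : ∀ {t₀ p s t} → s ≤ t → advance s (advance t₀ p s) t ≡ advance t₀ p t
  advance-advance {t₀} {p} {s} {t} s≤t = begin
    ((p + (s - t₀)) ⊓ half s + (t - s)) ⊓ half t
      ≡⟨ cong (_⊓ half t) (mono-≤-distrib-⊓ (cong (_+ (t - s))) (+-monoˡ-≤ (t - s)) _ _) ⟩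
    (p + (s - t₀) + (t - s)) ⊓ (half s + (t - s)) ⊓ half t
      ≡⟨ ⊓-assoc _ _ _ ⟩
    (p + (s - t₀) + (t - s)) ⊓ ((half s + (t - s)) ⊓ half t)
      ≡⟨ cong₂ _⊓_ shift (x≤y⇒y⊓x≈x (half-speed≤1 s≤t)) ⟩
    (p + (t - t₀)) ⊓ half t ∎
    where
    open ≡-Reasoning
    shift : p + (s - t₀) + (t - s) ≡ p + (t - t₀)
    shift = trans (+-assoc p (s - t₀) (t - s))
      (cong (p +_) (trans (+-comm (s - t₀) (t - s)) (sub-telescope t₀ s t)))

  advance-hits : ∀ {d p} → 0# < d → InCone d p →
                 ∃ λ t → d < t × t ≤ d + d + half d × advance d p t ≡ d
  advance-hits {d} {p} 0<d (p≤ , -p≤) with ≤-total 0# p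
  -- The edge of the cone reaches `d` at time `2 d`. From `p ≥ 0` the free motion is at `p + d ≥ d`
  -- by then, so the minimum is the edge.
  ... | inj₁ 0≤p = d + d , d<d+d ,
    subst (_≤ d + d + half d) (+-identityʳ (d + d)) (+-monoʳ-≤ (d + d) 0≤half) ,
    trans (cong₂ _⊓_ (cong (p +_) (x+z-z≡x d d)) (half-double d))
      (x≤y⇒y⊓x≈x (subst (_≤ p + d) (+-identityˡ d) (+-monoˡ-≤ d 0≤p)))
    where
    0≤half : 0# ≤ half d
    0≤half = ≤-trans 0≤p p≤
    d<d+d : d < d + d
    d<d+d = ≰⇒> λ d+d≤d → <⇒≱ 0<d
      (+-cancelʳ-≤ d (subst (d + d ≤_) (sym (+-identityˡ d)) d+d≤d))
  -- From `p ≤ 0` the free motion takes a further time `d - p` to arrive, and at time `2 d - p` the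
  -- edge is already at or past `d`. The cone bounds the delay: `- p ≤ half d`.
  ... | inj₂ p≤0 = d + d - p , d<t , +-monoʳ-≤ (d + d) -p≤ ,
    trans (cong (_⊓ half (d + d - p)) arrive) (x≤y⇒x⊓y≈x d≤half)
    where
    0≤-p : 0# ≤ - p
    0≤-p = subst (_≤ - p) -0#≈0# (neg-antimono-≤ p≤0)
    d<t : d < d + d - p
    d<t = ≰⇒> λ t≤d → <⇒≱ (+-pos-nonNeg 0<d 0≤-p)
      (+-cancelʳ-≤ d (subst₂ _≤_ (solve 2 (λ d q → d :+ d :+ q := d :+ q :+ d) refl d (- p))
        (sym (+-identityˡ d)) t≤d))
    arrive : p + (d + d - p - d) ≡ d
    arrive = +-cancelʳ-≡ d (trans (+-sub-comm p (d + d - p) d)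
      (trans (+-comm p (d + d - p)) (x-z+z≡x (d + d) p)))
    d≤half : d ≤ half (d + d - p)
    d≤half = subst (_≤ half (d + d - p)) (half-double d)
      (half-mono-≤ (subst (_≤ d + d - p) (+-identityʳ (d + d)) (+-monoʳ-≤ (d + d) 0≤-p)))

  -- Leftward motion is the mirror image of rightward motion, so facts about `step` follow from
  -- those about `advance` by reflection.
  step : Direction → ℝ → ℝ → ℝ → ℝ
  step s t₀ p t = orient s (advance t₀ (orient s p) t)

  step-inCone : ∀ s {t₀ p t} → t₀ ≤ t → InCone t₀ p → InCone t (step s t₀ p t)
  step-inCone s t₀≤t cone = inCone-orient s (advance-inCone t₀≤t (inCone-orient s cone))

  step-reachable : ∀ s {t₀ p t} → t₀ ≤ t → InCone t₀ p → Reachable t₀ t p (step s t₀ p t)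
  step-reachable s {t₀} {p} {t} t₀≤t cone =
    subst (λ x → Reachable t₀ t x (step s t₀ p t)) (orient-involutive s p)
      (reachable-orient s (advance-reachable t₀≤t (inCone-orient s cone)))

  step-start : ∀ s {t p} → InCone t p → step s t p t ≡ p
  step-start s {t} {p} cone =
    trans (cong (orient s) (advance-start (inCone-orient s cone))) (orient-involutive s p)

  step-step : ∀ s {t₀ p t₁ t} → t₁ ≤ t → step s t₁ (step s t₀ p t₁) t ≡ step s t₀ p t
  step-step s {t₀} {p} {t₁} {t} t₁≤t = cong (orient s)
    (trans (cong (λ x → advance t₁ x t) (orient-involutive s _)) (advance-advance t₁≤t))

  step-hits : ∀ s {d p} → 0# < d → InCone d p →
              ∃ λ t → d < t × t ≤ d + d + half d × step s d p t ≡ orient s d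
  step-hits s 0<d cone with t , d<t , t≤ , hit ← advance-hits 0<d (inCone-orient s cone) =
    t , d<t , t≤ , cong (orient s) hit

  -- A chain of lower bounds: the tail is ordered from the time of the head, which is where the
  -- recursion of `chase` restarts.
  Ordered : ∀ {n} → ℝ → List (Message n) → Set
  Ordered t₀ []      = Unit
  Ordered t₀ (m ∷ h) = t₀ ≤ time m × Ordered (time m) h

  history-ordered : ∀ {n} {h : List (Message n)} → IsHistory h → Ordered 0# h
  history-ordered {h = h} hist = go h nonNegative chronological
    where
    open IsHistory hist
    precedes⇒≤ : ∀ {n} {m m′ : Message n} → m Precedes m′ → time m ≤ time m′
    precedes⇒≤ (inj₁ m<m′)       = proj₁ m<m′
    precedes⇒≤ (inj₂ (m≡m′ , _)) = ≤-reflexive m≡m′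
    go : ∀ {n t₀} (h : List (Message n)) → All (λ m → t₀ ≤ time m) h →
         AllPairs _Precedes_ h → Ordered t₀ h
    go []      _        _          = tt
    go (m ∷ h) (le ∷ _) (ms ∷ mss) = le , go h (All.map (λ {m′} → precedes⇒≤ {m = m} {m′}) ms) mss

  before-none : ∀ {n t₀ t} {h : List (Message n)} → t ≤ t₀ → Ordered t₀ h → before t h ≡ []
  before-none {h = []}    t≤t₀ _         = refl
  before-none {t = t} {h = m ∷ h} t≤t₀ (le , ord) =
    trans (filter-reject (λ m → time m <? t) λ m<t → <⇒≱ m<t t≤m) (before-none t≤m ord)
    where t≤m = ≤-trans t≤t₀ le

  -- A left fold, so that `senders H (m ∷ h)` unfolds to `senders` of the very set that `chase`
  -- carries past `m`.
  senders : ∀ {n} → Subset n → List (Message n) → Subset n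
  senders = foldl (λ H m → H ∪ ⁅ sender m ⁆)

  senders⁺ˡ : ∀ {n r} {H : Subset n} h → r ∈ H → r ∈ senders H h
  senders⁺ˡ []      r∈H = r∈H
  senders⁺ˡ (m ∷ h) r∈H = senders⁺ˡ h (p⊆p∪q _ r∈H)

  senders⁺ʳ : ∀ {n} {H : Subset n} {m h} → m ∈ₗ h → sender m ∈ senders H h
  senders⁺ʳ {h = m ∷ h} (here refl) = senders⁺ˡ h (x∈p∪q⁺ (inj₂ (x∈⁅x⁆ (sender m))))
  senders⁺ʳ             (there m∈h) = senders⁺ʳ m∈h

  senders⁻ : ∀ {n r} {H : Subset n} h → r ∈ senders H h →
             r ∈ H ⊎ ∃ λ m → m ∈ₗ h × sender m ≡ r
  senders⁻ []      r∈H = inj₁ r∈H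
  senders⁻ {H = H} (m ∷ h) r∈ with senders⁻ h r∈
  ... | inj₂ (m′ , m′∈h , eq) = inj₂ (m′ , there m′∈h , eq)
  ... | inj₁ r∈H∪m with x∈p∪q⁻ H _ r∈H∪m
  ...   | inj₁ r∈H = inj₁ r∈H
  ...   | inj₂ r∈m = inj₂ (m , here refl , sym (x∈⁅y⁆⇒x≡y (sender m) r∈m))

  -- The trajectory of a robot that chooses its direction anew at each message.

  module Chase {n} (leader : Subset n → Direction) where

    -- The robot is at p at time t₀, H is the set of robots heard by then, and h
    -- lists the messages from t₀ on.
    chase : Subset n → ℝ → ℝ → List (Message n) → ℝ → ℝ
    chase H t₀ p []      t = step (leader H) t₀ p t
    chase H t₀ p (m ∷ h) t with time m <? t
    ... | no  _ = step (leader H) t₀ p t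
    ... | yes _ = chase (H ∪ ⁅ sender m ⁆) (time m) (step (leader H) t₀ p (time m)) h t

    chase-before : ∀ {H t₀ p} h {t} → Ordered t₀ h → chase H t₀ p (before t h) t ≡ chase H t₀ p h t
    chase-before []      _ = refl
    chase-before {H} {t₀} {p} (m ∷ h) {t} (le , ord) with time m <? t in eq
    ... | no m≮t rewrite before-none (≮⇒≥ m≮t) ord = refl
    ... | yes m<t rewrite eq = chase-before h ord

    chase-start : ∀ {H t₀ p} h → InCone t₀ p → Ordered t₀ h → chase H t₀ p h t₀ ≡ p
    chase-start {H} []      cone _ = step-start (leader H) cone
    chase-start {H} {t₀} (m ∷ h) cone (le , ord) with time m <? t₀
    ... | no _      = step-start (leader H) cone
    ... | yes m<t₀ = contradiction le (<⇒≱ m<t₀)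

    -- Each `step` preserves the cone, so the bound holds whatever is announced, by whomever and
    -- whenever.
    chase-inCone : ∀ {H t₀ p} h {t} → InCone t₀ p → Ordered t₀ h → t₀ ≤ t →
                   InCone t (chase H t₀ p h t)
    chase-inCone {H} [] cone _ t₀≤t = step-inCone (leader H) t₀≤t cone
    chase-inCone {H} (m ∷ h) {t} cone (le , ord) t₀≤t with time m <? t
    ... | no _    = step-inCone (leader H) t₀≤t cone
    ... | yes m<t = chase-inCone h (step-inCone (leader H) le cone) ord (proj₁ m<t)

    chase-reachable : ∀ {H t₀ p} h {s t} → InCone t₀ p → Ordered t₀ h → t₀ ≤ s → s ≤ t →
                      Reachable s t (chase H t₀ p h s) (chase H t₀ p h t)
    chase-reachable {H} {t₀} {p} h {s} {t} cone ord t₀≤s s≤t = go h ord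
      where
      step-s-t : Reachable s t (step (leader H) t₀ p s) (step (leader H) t₀ p t)
      step-s-t = subst (Reachable s t _) (step-step (leader H) s≤t)
        (step-reachable (leader H) s≤t (step-inCone (leader H) t₀≤s cone))
      go : ∀ h → Ordered t₀ h → Reachable s t (chase H t₀ p h s) (chase H t₀ p h t)
      go []      _ = step-s-t
      go (m ∷ h) (le , ord) with time m <? s | time m <? t
      ... | no _    | no _    = step-s-t
      ... | yes m<s | no m≮t  = contradiction (≤-trans s≤t (≮⇒≥ m≮t)) (<⇒≱ m<s)
      ... | yes m<s | yes _   =
        chase-reachable h (step-inCone (leader H) le cone) ord (proj₁ m<s) s≤t
      -- The head message falls between `s` and `t`: the motion is split at its time into a `step`
      -- and a chase that starts there.
      ... | no m≮s  | yes m<t = reachable-trans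
        (subst (Reachable s (time m) _) (step-step (leader H) s≤m)
          (step-reachable (leader H) s≤m (step-inCone (leader H) t₀≤s cone)))
        (subst (λ x → Reachable (time m) t x (chase H′ (time m) _ h t)) (chase-start {H′} h cone-m ord)
          (chase-reachable h cone-m ord ≤-refl (proj₁ m<t)))
        where
        s≤m = ≮⇒≥ m≮s
        H′ = H ∪ ⁅ sender m ⁆
        cone-m = step-inCone (leader H) le cone

    -- Messages after `t₁` that keep the direction `s` only cut one `step` into consecutive ones,
    -- which `step-step` joins again. The hypothesis speaks of times strictly after `t₁` because
    -- `before t` omits messages sent at `t` itself.
    chase-follow : ∀ {H t₀ p} h {s t₁ t} → InCone t₀ p → Ordered t₀ h → t₀ ≤ t₁ → t₁ < t →
                   (∀ {t} → t₁ < t → leader (senders H (before t h)) ≡ s) →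
                   chase H t₀ p h t ≡ step s t₁ (chase H t₀ p h t₁) t
    chase-follow {H} {t₀} {p} [] {s} {t₁} {t} cone ord t₀≤t₁ t₁<t lead
      rewrite lead t₁<t = sym (step-step s (proj₁ t₁<t))
    chase-follow {H} {t₀} {p} (m ∷ h) {s} {t₁} {t} cone (le , ord) t₀≤t₁ t₁<t lead = go
      where
      -- Up to the head message the set heard is `H`, so a single time after `t₁` in this stretch
      -- fixes the direction of the first step.
      lead-H : ∀ {t} → t₁ < t → t ≤ time m → leader H ≡ s
      lead-H {t} t₁<t t≤m = trans
        (cong (leader ∘ senders H) (sym (before-none t≤m (≤-refl , ord)))) (lead t₁<t)
      lead-tail : ∀ {t} → t₁ < t → time m < t →
                  leader (senders (H ∪ ⁅ sender m ⁆) (before t h)) ≡ s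
      lead-tail {t} t₁<t m<t = trans
        (cong (leader ∘ senders H) (sym (filter-accept (λ m → time m <? t) m<t))) (lead t₁<t)
      cone-m = step-inCone (leader H) le cone
      go : chase H t₀ p (m ∷ h) t ≡ step s t₁ (chase H t₀ p (m ∷ h) t₁) t
      go with time m <? t₁ | time m <? t
      ... | yes m<t₁ | no m≮t   = contradiction (≤-trans (proj₁ t₁<t) (≮⇒≥ m≮t)) (<⇒≱ m<t₁)
      ... | yes m<t₁ | yes _    = chase-follow h cone-m ord (proj₁ m<t₁) t₁<t
        λ t₁<t → lead-tail t₁<t (<-trans m<t₁ t₁<t)
      ... | no _     | no m≮t
        rewrite lead-H t₁<t (≮⇒≥ m≮t) = sym (step-step s (proj₁ t₁<t))
      ... | no m≮t₁  | yes m<t  = begin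
        chase H′ (time m) pₘ h t
          ≡⟨ chase-follow h cone-m ord ≤-refl m<t (λ m<t → lead-tail (≤-<-trans t₁≤m m<t) m<t) ⟩
        step s (time m) (chase H′ (time m) pₘ h (time m)) t
          ≡⟨ cong (λ x → step s (time m) x t) (chase-start {H′} h cone-m ord) ⟩
        step s (time m) pₘ t
          ≡⟨ rest (<-cmp t₁ (time m)) ⟩
        step s t₁ (step (leader H) t₀ p t₁) t ∎
        where
        open ≡-Reasoning
        t₁≤m = ≮⇒≥ m≮t₁
        H′ = H ∪ ⁅ sender m ⁆
        pₘ = step (leader H) t₀ p (time m)
        rest : Tri (t₁ < time m) (t₁ ≡ time m) (time m < t₁) →
               step s (time m) pₘ t ≡ step s t₁ (step (leader H) t₀ p t₁) t
        -- With the message exactly at `t₁`, the step taken under `H` ends there, and its direction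
        -- may differ from `s`.
        rest (tri≈ _ refl _)   = refl
        rest (tri> _ _ m<t₁)   = contradiction m<t₁ m≮t₁
        rest (tri< t₁<m _ _)
          rewrite lead-H t₁<m ≤-refl =
            trans (step-step s (proj₁ m<t)) (sym (step-step s (proj₁ t₁<t)))

-- The search algorithm: two packs and the scouts.

module Strategy (𝓡 : CompleteOrderedField) {f M : ℕ} (f≤M : f ℕ.≤ M) where
  open CompleteOrderedField 𝓡
  open OrderedField 𝓡
  open Motion 𝓡
  open Search 𝓡

  n : ℕ
  n = suc f ℕ.+ (suc f ℕ.+ M)

  -- The robots without a direction are the scouts.
  roles : Vec (Maybe Direction) n
  roles = replicate (suc f) (just right) Vec.++
          (replicate (suc f) (just left) Vec.++ replicate M nothing)

  inPack : Direction → Maybe Direction → Bool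
  inPack right (just right) = inside
  inPack left  (just left)  = inside
  inPack _     _            = outside

  pack : Direction → Subset n
  pack s = Vec.map (inPack s) roles

  ∣pack∣ : ∀ s → ∣ pack s ∣ ≡ suc f
  ∣pack∣ s = begin
    ∣ pack s ∣
      ≡⟨ ∣map-++∣ g (replicate (suc f) (just right)) _ ⟩
    block (suc f) (just right) ℕ.+
      ∣ Vec.map g (replicate (suc f) (just left) Vec.++ replicate M nothing) ∣
      ≡⟨ cong (block (suc f) (just right) ℕ.+_)
           (∣map-++∣ g (replicate (suc f) (just left)) (replicate M nothing)) ⟩
    block (suc f) (just right) ℕ.+ (block (suc f) (just left) ℕ.+ block M nothing)
      ≡⟨ cong₂ ℕ._+_ (∣block∣ (suc f) (just right))
           (cong₂ ℕ._+_ (∣block∣ (suc f) (just left)) (∣block∣ M nothing)) ⟩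
    ∣ replicate (suc f) (g (just right)) ∣ ℕ.+
      (∣ replicate (suc f) (g (just left)) ∣ ℕ.+ ∣ replicate M (g nothing) ∣)
      ≡⟨ count s ⟩
    suc f ∎
    where
    open ≡-Reasoning
    g = inPack s
    block : ℕ → Maybe Direction → ℕ
    block k ρ = ∣ Vec.map g (replicate k ρ) ∣
    ∣block∣ : ∀ k ρ → block k ρ ≡ ∣ replicate k (g ρ) ∣
    ∣block∣ k ρ = cong ∣_∣ (map-replicate g ρ k)
    count : ∀ s → ∣ replicate (suc f) (inPack s (just right)) ∣ ℕ.+
            (∣ replicate (suc f) (inPack s (just left)) ∣ ℕ.+
             ∣ replicate M (inPack s nothing) ∣) ≡ suc f
    count right rewrite ∣⊤∣≡n f | ∣⊥∣≡0 f | ∣⊥∣≡0 M = ℕ.+-identityʳ (suc f)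
    count left  rewrite ∣⊤∣≡n f | ∣⊥∣≡0 f | ∣⊥∣≡0 M = ℕ.+-identityʳ (suc f)

  pack-role : ∀ {r} s → r ∈ pack s → lookup roles r ≡ just s
  pack-role {r} s r∈ = go s (lookup roles r)
    (trans (sym (lookup-map r (inPack s) roles)) ([]=⇒lookup r∈))
    where
    go : ∀ s ρ → inPack s ρ ≡ inside → ρ ≡ just s
    go left  (just left)  _ = refl
    go right (just right) _ = refl

  -- With the target on side `s`, these are the roles whose reliable robots visit it in time: a pack
  -- at time `d`, and the scouts later.
  ∁pack-role : ∀ {r} s → r ∉ pack (opposite s) →
               lookup roles r ≡ just s ⊎ lookup roles r ≡ nothing
  ∁pack-role {r} s r∉ = go s (lookup roles r) λ eq →
    r∉ (lookup⇒[]= r _ (trans (lookup-map r (inPack (opposite s)) roles) eq))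
    where
    go : ∀ s ρ → ¬ inPack (opposite s) ρ ≡ inside → ρ ≡ just s ⊎ ρ ≡ nothing
    go s     nothing      _ = inj₂ refl
    go left  (just left)  _ = inj₁ refl
    go left  (just right) ≢ = contradiction refl ≢
    go right (just left)  ≢ = contradiction refl ≢
    go right (just right) _ = inj₁ refl

  -- Ties, including the initial silence, go left; the analysis relies on strict majorities only.
  leader : Subset n → Direction
  leader H with ∣ pack left ∩ H ∣ ℕ.<? ∣ pack right ∩ H ∣
  ... | yes _ = right
  ... | no  _ = left

  leader-majority : ∀ s {H} → ∣ pack (opposite s) ∩ H ∣ ℕ.< ∣ pack s ∩ H ∣ → leader H ≡ s
  leader-majority s {H} lt with ∣ pack left ∩ H ∣ ℕ.<? ∣ pack right ∩ H ∣ | s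
  ... | yes _   | right = refl
  ... | yes lt′ | left  = contradiction lt (ℕ.<-asym lt′)
  ... | no ¬lt  | right = contradiction lt ¬lt
  ... | no _    | left  = refl

  open Chase leader

  travel : Maybe Direction → List (Message n) → ℝ → ℝ
  travel (just s) h t = orient s t
  travel nothing  h t = chase ⊥ 0# 0# h t

  inCone-0 : InCone 0# 0#
  inCone-0 = ≤-reflexive 0≡half , ≤-reflexive (trans -0#≈0# 0≡half)
    where
    0≡half : 0# ≡ half 0#
    0≡half = trans (sym (half-double 0#)) (cong half (+-identityʳ 0#))

  travel-legal : ∀ ρ {h} → Ordered 0# h → IsTrajectory (λ t → travel ρ (before t h) t)
  travel-legal (just s) ord = record
    { start   = start s
    ; speed≤1 = λ t u _ t≤u → reachable-orient s (≤-refl , ≤-add⇒sub-≤ (+-mono-≤ t≤u t≤u)) }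
    where
    start : ∀ s → orient s 0# ≡ 0#
    start left  = -0#≈0#
    start right = refl
  travel-legal nothing {h} ord = record
    { start   = trans (chase-before h ord) (chase-start h inCone-0 ord)
    ; speed≤1 = λ t u 0≤t t≤u →
        subst₂ (Reachable t u) (sym (chase-before h ord)) (sym (chase-before h ord))
          (chase-reachable h inCone-0 ord 0≤t t≤u) }

  algorithm : Algorithm n
  algorithm = record
    { plan           = λ h r → travel (lookup roles r) h
    ; assigned-legal = λ h hist r → travel-legal (lookup roles r) (history-ordered hist) }

  opposite-≢ : ∀ s {t d} → 0# ≤ t → 0# < d → orient (opposite s) t ≢ orient s d
  opposite-≢ s {t} {d} 0≤t 0<d eq =
    0<⇒≢0 (+-pos-nonNeg 0<d 0≤t) (trans (+-comm d t) (vanish s eq))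
    where
    vanish : ∀ s → orient (opposite s) t ≡ orient s d → t + d ≡ 0#
    vanish left  t≡-d = trans (cong (_+ d) t≡-d) (-‿inverseˡ d)
    vanish right -t≡d = trans (cong (t +_) (sym -t≡d)) (-‿inverseʳ t)

  -- Analysis of a run with the target at distance `d` in direction `s`.

  module _ (ρ : Run algorithm f) {s d} (0<d : 0# < d) (target≡ : target ρ ≡ orient s d) where

    private
      ordered : Ordered 0# (messages ρ)
      ordered = history-ordered (messages-legal ρ)

    position-pack : ∀ {r} s′ → r ∉ faulty ρ → lookup roles r ≡ just s′ →
                    ∀ {t} → 0# ≤ t → position ρ r t ≡ orient s′ t
    position-pack s′ r∉ role {t} 0≤t =
      trans (reliable-follow ρ _ r∉ t 0≤t) (cong (λ x → travel x (before t (messages ρ)) t) role)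

    position-scout : ∀ {r} → r ∉ faulty ρ → lookup roles r ≡ nothing →
                     ∀ {t} → 0# ≤ t → position ρ r t ≡ chase ⊥ 0# 0# (messages ρ) t
    position-scout r∉ role {t} 0≤t = trans (reliable-follow ρ _ r∉ t 0≤t)
      (trans (cong (λ x → travel x (before t (messages ρ)) t) role)
        (chase-before (messages ρ) ordered))

    pack-reports : ∀ {r} → lookup roles r ≡ just s → r ∉ faulty ρ →
                   ∃ λ m → m ∈ₗ messages ρ × sender m ≡ r × time m ≤ d
    pack-reports role r∉ = reliable-report ρ _ r∉ d (proj₁ 0<d)
      (trans (position-pack s r∉ role (proj₁ 0<d)) (sym target≡))

    -- The location stamp is the true position of the sender. A reliable member of the opposite pack
    -- is on the wrong side of the origin or at it, so it cannot honestly announce the target.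
    opposite-lies : ∀ {m} → m ∈ₗ messages ρ → sender m ∈ pack (opposite s) → sender m ∈ faulty ρ
    opposite-lies {m} m∈ sender∈ = decidable-stable (sender m ∈? faulty ρ) λ sender∉ →
      opposite-≢ s 0≤m 0<d
        (trans (sym (position-pack (opposite s) sender∉ (pack-role (opposite s) sender∈) 0≤m))
          (trans (sym (location-true ρ m m∈)) (trans (reliable-honest ρ m m∈ sender∉) target≡)))
      where 0≤m = All.lookup (IsHistory.nonNegative (messages-legal ρ)) m∈

    -- The reliable members of `pack s` have reported by time `d`, hence strictly before `t`, so
    -- `truthful-majority` applies at every such `t`, whatever the liars add.
    leader-truthful : ∀ {t} → d < t → leader (senders ⊥ (before t (messages ρ))) ≡ s
    leader-truthful {t} d<t = leader-majority s
      (truthful-majority (pack s) (pack (opposite s)) (faulty ρ) _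
        (subst (∣ faulty ρ ∣ ℕ.<_) (sym (∣pack∣ s)) (ℕ.s≤s (faulty-bound ρ))) heard lying)
      where
      heard : ∀ {r} → r ∈ pack s → r ∉ faulty ρ → r ∈ senders ⊥ (before t (messages ρ))
      heard r∈ r∉ with m , m∈ , refl , m≤d ← pack-reports (pack-role s r∈) r∉ =
        senders⁺ʳ (∈-filter⁺ (λ m → time m <? t) m∈ (≤-<-trans m≤d d<t))
      lying : ∀ {r} → r ∈ pack (opposite s) → r ∈ senders ⊥ (before t (messages ρ)) →
              r ∈ faulty ρ
      lying r∈ r∈senders with senders⁻ (before t (messages ρ)) r∈senders
      ... | inj₁ r∈⊥             = contradiction r∈⊥ ∉⊥
      ... | inj₂ (m , m∈ , refl) =
        opposite-lies (proj₁ (∈-filter⁻ (λ m → time m <? t) m∈)) r∈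

    -- After time `d` the direction is constant, so the chase is a single `step` from a point of the
    -- cone, however the scouts were misled before.
    scouts-hit : ∃ λ t → d < t × t ≤ d + d + half d ×
                 chase ⊥ 0# 0# (messages ρ) t ≡ orient s d
    scouts-hit =
      let t , d<t , t≤ , hit =
            step-hits s 0<d (chase-inCone (messages ρ) inCone-0 ordered (proj₁ 0<d))
      in t , d<t , t≤ ,
         trans (chase-follow (messages ρ) inCone-0 ordered (proj₁ 0<d) d<t leader-truthful) hit

    reports : ∀ {r t} → d < t → chase ⊥ 0# 0# (messages ρ) t ≡ orient s d →
              r ∉ pack (opposite s) → r ∉ faulty ρ →
              ∃ λ m → m ∈ₗ messages ρ × sender m ≡ r × time m ≤ t
    reports {r} {t} d<t hit r∉pack r∉ with ∁pack-role s r∉pack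
    ... | inj₁ role with m , m∈ , from , m≤d ← pack-reports role r∉ =
      m , m∈ , from , ≤-trans m≤d (proj₁ d<t)
    ... | inj₂ role = reliable-report ρ r r∉ t 0≤t
      (trans (position-scout r∉ role 0≤t) (trans hit (sym target≡)))
      where 0≤t = ≤-trans (proj₁ 0<d) (proj₁ d<t)

    -- A run with the same messages but another target makes every robot that
    -- should have reported the target of ρ faulty in one of the two runs, and
    -- there are more than 2 f of them.
    certain : ∀ {t} → d < t → chase ⊥ 0# 0# (messages ρ) t ≡ orient s d → Certain ρ t
    certain {t} d<t hit σ same = decidable-stable (target σ ≟ target ρ) λ target≢ →
      ℕ.<⇒≱ (ℕ.n<1+n (f ℕ.+ f)) (begin
        suc (f ℕ.+ f)                    ≤⟨ ℕ.s≤s (ℕ.+-monoʳ-≤ f f≤M) ⟩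
        suc f ℕ.+ M                      ≡⟨ ℕ.m+n∸m≡n (suc f) (suc f ℕ.+ M) ⟨
        n ℕ.∸ suc f                      ≡⟨ cong (n ℕ.∸_) (∣pack∣ (opposite s)) ⟨
        n ℕ.∸ ∣ pack (opposite s) ∣      ≡⟨ ∣∁p∣≡n∸∣p∣ (pack (opposite s)) ⟨
        ∣ ∁ (pack (opposite s)) ∣        ≤⟨ p⊆q⇒∣p∣≤∣q∣ (liars target≢) ⟩
        ∣ faulty ρ ∪ faulty σ ∣          ≤⟨ ∣p∪q∣≤∣p∣+∣q∣ (faulty ρ) (faulty σ) ⟩
        ∣ faulty ρ ∣ ℕ.+ ∣ faulty σ ∣    ≤⟨ ℕ.+-mono-≤ (faulty-bound ρ) (faulty-bound σ) ⟩
        f ℕ.+ f                          ∎)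
      where
      open ℕ.≤-Reasoning
      witness : ∀ {r} → target σ ≢ target ρ → r ∉ faulty ρ → r ∉ faulty σ →
                ¬ ∃ λ m → m ∈ₗ messages ρ × sender m ≡ r × time m ≤ t
      witness target≢ r∉ρ r∉σ (m , m∈ , refl , m≤t) = target≢
        (trans (sym (reliable-honest σ m m∈σ r∉σ)) (reliable-honest ρ m m∈ r∉ρ))
        where
        m∈σ : m ∈ₗ messages σ
        m∈σ = proj₁ (∈-filter⁻ (λ m → time m ≤? t)
          (subst (m ∈ₗ_) (sym same) (∈-filter⁺ (λ m → time m ≤? t) m∈ m≤t)))
      liars : target σ ≢ target ρ → ∁ (pack (opposite s)) ⊆ faulty ρ ∪ faulty σ
      liars target≢ {r} r∈ = decidable-stable (r ∈? (faulty ρ ∪ faulty σ)) λ r∉ →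
        let r∉ρ = r∉ ∘ x∈p∪q⁺ ∘ inj₁
            r∉σ = r∉ ∘ x∈p∪q⁺ ∘ inj₂
        in witness target≢ r∉ρ r∉σ (reports d<t hit (x∈∁p⇒x∉p r∈) r∉ρ)

    -- The pack has `f + 1` members, so one of them is reliable, and it reports by time `d`.
    announced : ∀ {t} → d ≤ t → Announced ρ t
    announced d≤t
      with r , r∈ , r∉ ← ∃∈-∉ (subst (∣ faulty ρ ∣ ℕ.<_) (sym (∣pack∣ s)) (ℕ.s≤s (faulty-bound ρ)))
      with m , m∈ , refl , m≤d ← pack-reports (pack-role s r∈) r∉ =
      m , m∈ , r∉ , reliable-honest ρ m m∈ r∉ , ≤-trans m≤d d≤t

    completed : ∃ λ t → t ≤ d + d + half d × Completed ρ t
    completed =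
      let t , d<t , t≤ , hit = scouts-hit
      in t , t≤ , announced (proj₁ d<t) , certain d<t hit

  search : ∀ {c} → (∀ {d} → 0# ≤ d → d + d + half d ≤ c * d) → S[ n , f ]≤ c
  search bound = algorithm , λ d 0<d ρ at-±d →
    let t , t≤ , done = completed-±d ρ 0<d at-±d in
    t , ≤-trans t≤ (bound (proj₁ 0<d)) , done
    where
    completed-±d : ∀ (ρ : Run algorithm f) {d} → 0# < d → target ρ ≡ d ⊎ target ρ ≡ - d →
                   ∃ λ t → t ≤ d + d + half d × Completed ρ t
    completed-±d ρ 0<d (inj₁ at-d)  = completed ρ {right} 0<d at-d
    completed-±d ρ 0<d (inj₂ at--d) = completed ρ {left} 0<d at--d

-- The robot count and the resulting bound.

open import Data.Nat using (_+_; _*_; _/_; _%_; _≥_; _>_)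
open import Data.Nat.Divisibility using (_∣_; divides)

-- With `f = q * suc i` the total is `3 f + q + 2`, which splits into two packs of `f + 1` and
-- `f + q` scouts.
robot-count : ∀ i q → ((3 * i + 4) * (q * suc i)) / suc i + 2 ≡
                  suc (q * suc i) + (suc (q * suc i) + (q * suc i + q))
robot-count i q = trans
  (cong (_+ 2) (trans (cong (_/ suc i) (sym (ℕ.*-assoc (3 * i + 4) q (suc i))))
    (m*n/n≡m ((3 * i + 4) * q) (suc i))))
  (arithmetic i q)
  where
  arithmetic : ∀ i q → (3 * i + 4) * q + 2 ≡ suc (q * suc i) + (suc (q * suc i) + (q * suc i + q))
  arithmetic = solve-∀

lemma6 : (𝓡 : CompleteOrderedField) →
    let open CompleteOrderedField 𝓡 using (fromℕ)
        open CompleteOrderedField 𝓡 using (_-_)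
        open CompleteOrderedField 𝓡 using (_÷_)
        open Search 𝓡 using (S[_,_]≤_)
    in (i f : ℕ) → i ≥ 3 → i % 2 ≡ 1 → f > 0 → suc i ∣ f →
       S[ ((3 * i + 4) * f) / suc i + 2 , f ]≤ (fromℕ 3 - fromℕ 2 ÷ fromℕ (suc i))
lemma6 𝓡 i f i≥3 _ _ (divides q refl) =
  subst (λ n → S[ n , f ]≤ (fromℕ 3 - fromℕ 2 ÷ fromℕ (suc i))) (sym (robot-count i q))
    (search (5/2≤ratio i≥3))
  where
  open CompleteOrderedField 𝓡
  open Search 𝓡
  open OrderedField 𝓡
  open Strategy 𝓡 (ℕ.m≤m+n f q)
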